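{- Let $q\geq 3$ be a prime power and let $(\mathcal{P},\mathcal{G},\mathcal{B})$ be a resolvable transversal design $\mathrm{TD}(q-1,q)$. Let $\mathcal{C}_{\mathrm{TD}}(q)$ be the combinatorial batch code whose servers are the points in $\mathcal{P}$ and whose items are the blocks in $\mathcal{B}$ together with the groups in $\mathcal{G}$, where an item (a block or a group) is stored in exactly those servers that are the points it contains. Then $\mathcal{C}_{\mathrm{TD}}(q)$ is a $(q^2+q-1,\; q^3-q,\; q^2-q-1,\; q^2-q)$-CBC.
   Context: An $(n,N,k,m)$-CBC (combinatorial batch code) consists of a set $\mathcal{S}$ of $m$ servers and $n$ items $x_1,\dots,x_n$, where item $x_j$ is stored in the servers of a subset $X_j\subseteq\mathcal{S}$, with total storage $\sum_{j=1}^n|X_j|=N$, such that any $k$ items can be retrieved by reading at most one item from each server; that is, for any $k$ distinct indices $i_1,\dots,i_k$ there exist pairwise distinct servers $s_1,\dots,s_k$ with $s_j\in X_{i_j}$ for all $j$. A transversal design $\mathrm{TD}(\ell,h)$ is a triple $(\mathcal{P},\mathcal{G},\mathcal{B})$ where $\mathcal{P}$ is a set of $\ell h$ points; $\mathcal{G}$ is a partition of $\mathcal{P}$ into $\ell$ sets (groups), each of size $h$; $\mathcal{B}$ is a collection of $\ell$-subsets of $\mathcal{P}$ (blocks); each block meets each group in exactly one point; and any pair of points from different groups is contained in exactly one block. (It has $h^2$ blocks, and each point lies in $h$ blocks.) It is resolvable if $\mathcal{B}$ can be partitioned into $h$ sets $\mathcal{B}_1,\dots,\mathcal{B}_h$ (parallel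 classes), each containing $h$ blocks, such that each point is contained in exactly one block of each $\mathcal{B}_i$. -}

module Defs where

open import Data.Fin.Base using (Fin)
open import Data.Fin.Subset using (Subset; _∈_; ∣_∣)
open import Data.Nat.Base using (ℕ; _+_; _*_; _^_; _≤_)
open import Data.Nat.Primality using (Prime)
open import Data.Nat.Properties using (+-0-commutativeMonoid)
open import Data.Product using (∃; ∃!; ∃₂; _×_)
open import Data.Vec.Functional using (Vector; _++_)
open import Function.Definitions using (Injective)
open import Relation.Binary.PropositionalEquality using (_≡_; _≢_)

open import Algebra.Properties.CommutativeMonoid.Sum +-0-commutativeMonoid
  using (sum)

IsPrimePower : ℕ → Set
IsPrimePower q = ∃₂ λ p e → Prime p × 1 ≤ e × q ≡ p ^ e

-- Nonemptiness of the parts is not required here: wherever this is used,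
-- the sizes of the parts are prescribed separately.
IsPartition : ∀ {r v} → Vector (Subset v) r → Set
IsPartition X = ∀ p → ∃! _≡_ λ i → p ∈ X i

-- Blocks form an indexed family whose length is not prescribed.  Repeated
-- blocks are not excluded by hand; pair-in-unique-block rules them out as
-- soon as ℓ ≥ 2.
record TransversalDesign (ℓ h : ℕ) : Set where
  field
    #blocks : ℕ
    group   : Vector (Subset (ℓ * h)) ℓ
    block   : Vector (Subset (ℓ * h)) #blocks

    groups-partition : IsPartition group
    group-size       : ∀ i → ∣ group i ∣ ≡ h
    block-size       : ∀ b → ∣ block b ∣ ≡ ℓ
    block-meets-group-once :
      ∀ b i → ∃! _≡_ λ p → p ∈ block b × p ∈ group i
    pair-in-unique-block :
      ∀ {i j p r} → i ≢ j → p ∈ group i → r ∈ group j →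
      ∃! _≡_ λ b → p ∈ block b × r ∈ block b

-- A parallel class is given as a set of block indices.
record Resolvable {ℓ h : ℕ} (D : TransversalDesign ℓ h) : Set where
  open TransversalDesign D
  field
    class             : Vector (Subset #blocks) h
    classes-partition : IsPartition class
    class-size        : ∀ c → ∣ class c ∣ ≡ h
    class-parallel    : ∀ c p → ∃! _≡_ λ b → b ∈ class c × p ∈ block b

-- Item i is stored in exactly the servers belonging to stored i.
record StorageScheme : Set where
  field
    #items   : ℕ
    #servers : ℕ
    stored   : Vector (Subset #servers) #items

record IsCBC (n N k m : ℕ) (C : StorageScheme) : Set where
  open StorageScheme C
  field
    items       : #items ≡ n
    servers     : #servers ≡ m
    storage     : sum (λ i → ∣ stored i ∣) ≡ N
    retrievable :
      ∀ (x : Fin k → Fin #items) → Injective _≡_ _≡_ x →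
      ∃ λ (s : Fin k → Fin #servers) →
        Injective _≡_ _≡_ s × (∀ j → s j ∈ stored (x j))

designCode : ∀ {ℓ h} → TransversalDesign ℓ h → StorageScheme
designCode {ℓ} {h} D = record
  { #items   = #blocks + ℓ
  ; #servers = ℓ * h
  ; stored   = block ++ group
  }
  where open TransversalDesign D

{-# OPTIONS --safe #-}
module Submission where

-- Blocks and groups together form a pairwise balanced design: every point lies on
-- q + 1 items and any two points lie on exactly one common item.  By Hall's theorem it
-- suffices that at most |Z| of any k chosen items lie inside a point set Z.  Let U be the
-- complement of Z, u = |U|, and x_i the number of points of U on item i.  If u ≤ 1, then
-- |Z| ≥ k.  Otherwise ∑ x_i = u (q + 1) and ∑ x_i² = u (u + q), and
-- ∑ (x_i − a)(x_i − a − 1) ≥ 0, in which every item inside Z contributes a (a + 1),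
-- bounds the number of such items by |Z|: take a = 1 if u ≤ 2q − 1, and a = q − 1
-- if u ≥ 2q − 1.

open import Defs
open import Data.Bool.Base using (Bool; true; false)
open import Data.Fin.Base using (Fin; zero; suc; punchIn; punchOut; splitAt)
open import Data.Fin.Properties
  using (_≟_; any?; all?; punchInᵢ≢i; punchIn-punchOut; punchOut-injective; suc-injective; 0≢1+n)
open import Data.Fin.Subset using (Subset; _∈_; _∉_; _⊆_; _∪_; _∩_; _-_; ∁; ⁅_⁆; ∣_∣; Nonempty)
open import Data.Fin.Subset.Properties
open import Data.Nat.Base using (ℕ; zero; suc; _+_; _*_; _∸_; _^_; _≤_; _<_; z≤n; s≤s)
open import Data.Nat.Induction using (<-wellFounded)
open import Data.Nat.Properties hiding (_≟_; suc-injective; 0≢1+n)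
open import Data.Nat.Tactic.RingSolver using (solve-∀)
open import Data.Product using (∃; ∃!; ∃₂; _×_; _,_; proj₁; proj₂)
open import Data.Sum as Sum using (inj₁; inj₂)
open import Data.Vec.Base using ([]; _∷_; lookup; there)
open import Data.Vec.Functional using (Vector; _++_; updateAt; removeAt)
open import Data.Vec.Functional.Properties using (updateAt-updates; updateAt-minimal)
open import Data.Vec.Properties using ([]=⇒lookup; lookup⇒[]=)
open import Function.Base using (_∘_)
open import Function.Definitions using (Injective)
open import Induction.WellFounded using (Acc; acc)
open import Relation.Binary.PropositionalEquality
open import Relation.Nullary using (¬_; Dec; yes; no; contradiction)
open import Relation.Nullary.Decidable using (_×-dec_; _→-dec_; ¬?)
open import Algebra.Properties.Semiring.Sum +-*-semiring
  using (sum; sum-syntax; sum-cong-≗; sum-remove; ∑-distrib-+; ∑-comm; *-distribˡ-sum; *-distribʳ-sum)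

private
  variable
    k m n v : ℕ

-- Finite sums of natural numbers

sum-mono-≤ : {f g : Fin n → ℕ} → (∀ i → f i ≤ g i) → sum f ≤ sum g
sum-mono-≤ {zero}  f≤g = z≤n
sum-mono-≤ {suc n} f≤g = +-mono-≤ (f≤g zero) (sum-mono-≤ (f≤g ∘ suc))

sum-mono-< : {f g : Fin n → ℕ} → (∀ i → f i ≤ g i) → ∀ i → f i < g i → sum f < sum g
sum-mono-< f≤g zero    fi<gi = +-mono-<-≤ fi<gi (sum-mono-≤ (f≤g ∘ suc))
sum-mono-< f≤g (suc i) fi<gi = +-mono-≤-< (f≤g zero) (sum-mono-< (f≤g ∘ suc) i fi<gi)

sum-const : ∀ n c → sum {n} (λ _ → c) ≡ n * c
sum-const zero    c = refl
sum-const (suc n) c = cong (c +_) (sum-const n c)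

sum-≡0 : {f : Fin n → ℕ} → (∀ i → f i ≡ 0) → sum f ≡ 0
sum-≡0 {n} f≡0 = trans (sum-cong-≗ f≡0) (trans (sum-const n 0) (*-zeroʳ n))

sum-support : ∀ (f : Fin n → ℕ) i → (∀ j → j ≢ i → f j ≡ 0) → sum f ≡ f i
sum-support {suc n} f i f≡0 = begin
  sum f                     ≡⟨ sum-remove f ⟩
  f i + sum (removeAt f i)  ≡⟨ cong (f i +_) (sum-≡0 λ j → f≡0 _ (punchInᵢ≢i i j)) ⟩
  f i + 0                   ≡⟨ +-identityʳ (f i) ⟩
  f i                       ∎
  where open ≡-Reasoning

-- Turns the `∃!` axioms of designs and resolutions into counts equal to one.
sum-∃! : {P : Fin n → Set} {f : Fin n → ℕ} → ∃! _≡_ P →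
  (∀ {i} → P i → f i ≡ 1) → (∀ {i} → ¬ P i → f i ≡ 0) → sum f ≡ 1
sum-∃! {f = f} (i , Pi , unique) f≡1 f≡0 = trans
  (sum-support f i λ j j≢i → f≡0 λ Pj → j≢i (sym (unique Pj)))
  (f≡1 Pi)

sum-++ : {A : Set} (f : A → ℕ) (xs : Vector A m) (ys : Vector A n) →
  sum (f ∘ (xs ++ ys)) ≡ sum (f ∘ xs) + sum (f ∘ ys)
sum-++ {zero}  f xs ys = refl
sum-++ {suc m} f xs ys = begin
  f (xs zero) + sum (f ∘ (xs ++ ys) ∘ suc)
    ≡⟨ cong (f (xs zero) +_) (trans (sum-cong-≗ shift) (sum-++ f (xs ∘ suc) ys)) ⟩
  f (xs zero) + (sum (f ∘ xs ∘ suc) + sum (f ∘ ys))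
    ≡⟨ +-assoc (f (xs zero)) _ _ ⟨
  sum (f ∘ xs) + sum (f ∘ ys)
    ∎
  where
  open ≡-Reasoning
  -- `_++_` branches on `splitAt`, so both sides compute only once `splitAt m i` is resolved.
  shift : ∀ i → f ((xs ++ ys) (suc i)) ≡ f (((xs ∘ suc) ++ ys) i)
  shift i with splitAt m i
  ... | inj₁ _ = refl
  ... | inj₂ _ = refl

-- Induction on `k`: the value `x zero` is split off, and `punchOut` sends the remaining values
-- injectively into the indices other than `x zero`.
sum-injective-≤ : ∀ (x : Fin k → Fin n) → Injective _≡_ _≡_ x →
  ∀ (f : Fin n → ℕ) → sum (f ∘ x) ≤ sum f
sum-injective-≤ {zero}          x inj f = z≤n
sum-injective-≤ {suc k} {zero}  x inj f with () ← x zero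
sum-injective-≤ {suc k} {suc n} x inj f = begin
  f (x zero) + sum (f ∘ x ∘ suc)
    ≡⟨ cong (f (x zero) +_) (sum-cong-≗ λ j → cong f (sym (punchIn-punchOut (x0≢ j)))) ⟩
  f (x zero) + sum (removeAt f (x zero) ∘ y)
    ≤⟨ +-monoʳ-≤ (f (x zero)) (sum-injective-≤ y y-injective (removeAt f (x zero))) ⟩
  f (x zero) + sum (removeAt f (x zero))
    ≡⟨ sum-remove f ⟨
  sum f
    ∎
  where
  open ≤-Reasoning
  x0≢ : ∀ j → x zero ≢ x (suc j)
  x0≢ j eq = 0≢1+n (inj eq)
  y : Fin k → Fin n
  y j = punchOut (x0≢ j)
  y-injective : Injective _≡_ _≡_ y
  y-injective {i} {j} eq = suc-injective (inj (punchOut-injective (x0≢ i) (x0≢ j) eq))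

-- Indicator functions of subsets

𝟙 : Bool → ℕ
𝟙 true  = 1
𝟙 false = 0

χ : Subset v → Fin v → ℕ
χ S p = 𝟙 (lookup S p)

χ-∈ : ∀ {S : Subset v} {p} → p ∈ S → χ S p ≡ 1
χ-∈ p∈S = cong 𝟙 ([]=⇒lookup p∈S)

χ-∉ : ∀ {S : Subset v} {p} → p ∉ S → χ S p ≡ 0
χ-∉ {S = S} {p} p∉S with lookup S p in eq
... | true  = contradiction (lookup⇒[]= p S eq) p∉S
... | false = refl

χ-idem : ∀ (S : Subset v) p → χ S p * χ S p ≡ χ S p
χ-idem S p with lookup S p
... | true  = refl
... | false = refl

χχ-∈ : ∀ {S : Subset m} {T : Subset n} {p r} → p ∈ S × r ∈ T → χ S p * χ T r ≡ 1
χχ-∈ (p∈S , r∈T) = cong₂ _*_ (χ-∈ p∈S) (χ-∈ r∈T)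

χχ-∉ : ∀ {S : Subset m} {T : Subset n} {p r} → ¬ (p ∈ S × r ∈ T) → χ S p * χ T r ≡ 0
χχ-∉ {S = S} {T} {p} {r} ¬both with p ∈? S
... | yes p∈S = trans (cong (χ S p *_) (χ-∉ λ r∈T → ¬both (p∈S , r∈T))) (*-zeroʳ (χ S p))
... | no  p∉S = cong (_* χ T r) (χ-∉ p∉S)

∣S∣≡∑χ : ∀ (S : Subset v) → ∣ S ∣ ≡ sum (χ S)
∣S∣≡∑χ []          = refl
∣S∣≡∑χ (true ∷ S)  = cong suc (∣S∣≡∑χ S)
∣S∣≡∑χ (false ∷ S) = ∣S∣≡∑χ S

∣S∣+∣∁S∣≡v : ∀ (S : Subset v) → ∣ S ∣ + ∣ ∁ S ∣ ≡ v
∣S∣+∣∁S∣≡v S = trans (cong (∣ S ∣ +_) (∣∁p∣≡n∸∣p∣ S)) (m+[n∸m]≡n (∣p∣≤n S))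

∣∪∣+∣∩∣ : ∀ (S T : Subset v) → ∣ S ∪ T ∣ + ∣ S ∩ T ∣ ≡ ∣ S ∣ + ∣ T ∣
∣∪∣+∣∩∣ []          []          = refl
∣∪∣+∣∩∣ (true ∷ S)  (true ∷ T)  = cong suc (begin
  ∣ S ∪ T ∣ + suc ∣ S ∩ T ∣    ≡⟨ +-suc _ _ ⟩
  suc (∣ S ∪ T ∣ + ∣ S ∩ T ∣)  ≡⟨ cong suc (∣∪∣+∣∩∣ S T) ⟩
  suc (∣ S ∣ + ∣ T ∣)          ≡⟨ +-suc _ _ ⟨
  ∣ S ∣ + suc ∣ T ∣            ∎)
  where open ≡-Reasoning
∣∪∣+∣∩∣ (true ∷ S)  (false ∷ T) = cong suc (∣∪∣+∣∩∣ S T)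
∣∪∣+∣∩∣ (false ∷ S) (true ∷ T)  = trans (cong suc (∣∪∣+∣∩∣ S T)) (sym (+-suc _ _))
∣∪∣+∣∩∣ (false ∷ S) (false ∷ T) = ∣∪∣+∣∩∣ S T

x∈S⇒1≤∣S∣ : ∀ {S : Subset v} {p} → p ∈ S → 1 ≤ ∣ S ∣
x∈S⇒1≤∣S∣ p∈S = ≤-trans (s≤s z≤n) (x∈p⇒∣p-x∣<∣p∣ p∈S)

1≤∣S∣⇒Nonempty : ∀ (S : Subset v) → 1 ≤ ∣ S ∣ → Nonempty S
1≤∣S∣⇒Nonempty {v} S 1≤∣S∣ with nonempty? S
... | yes ne = ne
... | no  e  = contradiction
  (subst (1 ≤_) (trans (cong ∣_∣ (Empty-unique e)) (∣⊥∣≡0 v)) 1≤∣S∣) (λ ())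

x∉S-x : ∀ (S : Subset v) x → x ∉ S - x
x∉S-x (_ ∷ S) (suc x) (there x∈) = x∉S-x S x x∈

∣S∣≤1+∣S-x∣ : ∀ (S : Subset v) x → ∣ S ∣ ≤ suc ∣ S - x ∣
∣S∣≤1+∣S-x∣ S x = begin
  ∣ S ∣                               ≤⟨ p⊆q⇒∣p∣≤∣q∣ S⊆ ⟩
  ∣ ⁅ x ⁆ ∪ (S - x) ∣                 ≤⟨ m≤m+n _ _ ⟩
  ∣ ⁅ x ⁆ ∪ (S - x) ∣ + ∣ ⁅ x ⁆ ∩ (S - x) ∣  ≡⟨ ∣∪∣+∣∩∣ ⁅ x ⁆ (S - x) ⟩
  ∣ ⁅ x ⁆ ∣ + ∣ S - x ∣               ≡⟨ cong (_+ ∣ S - x ∣) (∣⁅x⁆∣≡1 x) ⟩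
  suc ∣ S - x ∣                       ∎
  where
  open ≤-Reasoning
  S⊆ : S ⊆ ⁅ x ⁆ ∪ (S - x)
  S⊆ {y} y∈S with y ≟ x
  ... | yes refl = x∈p∪q⁺ (inj₁ (x∈⁅x⁆ x))
  ... | no  y≢x  = x∈p∪q⁺ (inj₂ (x∈p∧x≢y⇒x∈p-y y∈S y≢x))

-- Hall's theorem

-- The usual condition compares |J| with the size of the union of the chosen sets; ranging over all
-- `Z` that contain this union is equivalent and matches the point sets of the application.
HallCondition : Vector (Subset m) k → Set
HallCondition A = ∀ J Z → (∀ j → j ∈ J → A j ⊆ Z) → ∣ J ∣ ≤ ∣ Z ∣

-- The failure in positive form: a finite search decides it and yields the witnesses `J` and `Z`.
HallViolation : Vector (Subset m) k → Set
HallViolation A = ∃₂ λ J Z → (∀ j → j ∈ J → A j ⊆ Z) × ∣ Z ∣ < ∣ J ∣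

SDR : Vector (Subset m) k → Set
SDR {m} {k} A = ∃ λ (s : Fin k → Fin m) → Injective _≡_ _≡_ s × (∀ j → s j ∈ A j)

hallViolation? : ∀ (A : Vector (Subset m) k) → Dec (HallViolation A)
hallViolation? A = anySubset? λ J → anySubset? λ Z →
  all? (λ j → (j ∈? J) →-dec (A j ⊆? Z)) ×-dec (∣ Z ∣ <? ∣ J ∣)

delete : Vector (Subset m) k → Fin k → Fin m → Vector (Subset m) k
delete A i x = updateAt A i (_- x)

delete-≢ : ∀ (A : Vector (Subset m) k) {i j} x → j ≢ i → A j ≡ delete A i x j
delete-≢ A {i} {j} x j≢i = sym (updateAt-minimal j i A j≢i)

delete-∈ : ∀ (A : Vector (Subset m) k) i {x y} → y ∈ A i → y ≢ x → y ∈ delete A i x i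
delete-∈ A i y∈ y≢x = subst (_ ∈_) (sym (updateAt-updates i A)) (x∈p∧x≢y⇒x∈p-y y∈ y≢x)

delete-⊆ : ∀ (A : Vector (Subset m) k) i x j → delete A i x j ⊆ A j
delete-⊆ A i x j with j ≟ i
... | yes refl = λ y∈ → p─q⊆p (A i) ⁅ x ⁆ (subst (_ ∈_) (updateAt-updates i A) y∈)
... | no  j≢i  = subst (_ ∈_) (sym (delete-≢ A x j≢i))

-- This decrease drives the induction in `hall`.
delete-∣∣ : ∀ (A : Vector (Subset m) k) i {x} → x ∈ A i →
  sum (∣_∣ ∘ delete A i x) < sum (∣_∣ ∘ A)
delete-∣∣ A i {x} x∈ = sum-mono-< (λ j → p⊆q⇒∣p∣≤∣q∣ (delete-⊆ A i x j)) i
  (subst (λ S → ∣ S ∣ < ∣ A i ∣) (sym (updateAt-updates i A)) (x∈p⇒∣p-x∣<∣p∣ x∈))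

-- A violation (J , Z) after deleting x and a violation (K , W) after deleting y
-- contradict Hall's condition for (J ∪ K , Z ∪ W) and (J ∩ K - i , Z ∩ W),
-- since cardinality is modular.
delete-one-of-two : ∀ (A : Vector (Subset m) k) i {x y} → x ≢ y → HallCondition A →
  HallViolation (delete A i x) → ¬ HallViolation (delete A i y)
delete-one-of-two A i {x} {y} x≢y hall (J , Z , J⊆Z , Z<J) (K , W , K⊆W , W<K) =
  <-irrefl refl (begin-strict
    ∣ J ∣ + ∣ K ∣                        ≡⟨ ∣∪∣+∣∩∣ J K ⟨
    ∣ J ∪ K ∣ + ∣ J ∩ K ∣                ≤⟨ +-mono-≤ (hall (J ∪ K) (Z ∪ W) ∪-⊆) (∣S∣≤1+∣S-x∣ (J ∩ K) i) ⟩
    ∣ Z ∪ W ∣ + suc ∣ (J ∩ K) - i ∣      ≤⟨ +-monoʳ-≤ ∣ Z ∪ W ∣ (s≤s (hall ((J ∩ K) - i) (Z ∩ W) ∩-⊆)) ⟩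
    ∣ Z ∪ W ∣ + suc ∣ Z ∩ W ∣            ≡⟨ +-suc _ _ ⟩
    suc (∣ Z ∪ W ∣ + ∣ Z ∩ W ∣)          ≡⟨ cong suc (∣∪∣+∣∩∣ Z W) ⟩
    suc (∣ Z ∣ + ∣ W ∣)                  <⟨ s≤s (≤-reflexive (sym (+-suc _ _))) ⟩
    suc ∣ Z ∣ + suc ∣ W ∣                ≤⟨ +-mono-≤ Z<J W<K ⟩
    ∣ J ∣ + ∣ K ∣                        ∎)
  where
  open ≤-Reasoning
  away : ∀ {L Y w} j → j ≢ i → (∀ j → j ∈ L → delete A i w j ⊆ Y) → j ∈ L → A j ⊆ Y
  away j j≢i L⊆Y j∈L z∈ = L⊆Y j j∈L (subst (_ ∈_) (delete-≢ A _ j≢i) z∈)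

  -- If `i` were outside `L`, the deletion would touch no set of `L`, and Hall's condition for `A`
  -- would already fail at `L` and `Y`.
  i∈ : ∀ {L Y w} → (∀ j → j ∈ L → delete A i w j ⊆ Y) → ∣ Y ∣ < ∣ L ∣ → i ∈ L
  i∈ {L} {Y} L⊆Y Y<L with i ∈? L
  ... | yes i∈L = i∈L
  ... | no  i∉L = contradiction
    (hall L Y λ j j∈L → away j (λ { refl → i∉L j∈L }) L⊆Y j∈L) (<⇒≱ Y<L)

  ∪-⊆ : ∀ j → j ∈ J ∪ K → A j ⊆ Z ∪ W
  ∪-⊆ j j∈ {z} z∈ with j ≟ i
  ... | no j≢i = x∈p∪q⁺ (Sum.map (λ j∈J → away j j≢i J⊆Z j∈J z∈)
                                 (λ j∈K → away j j≢i K⊆W j∈K z∈) (x∈p∪q⁻ J K j∈))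
  -- An element of `A i` other than `x` survives the deletion of `x` and lies in `Z`; `x` itself
  -- survives the deletion of `y` and lies in `W`.
  ... | yes refl with z ≟ x
  ...   | yes refl = x∈p∪q⁺ (inj₂ (K⊆W i (i∈ K⊆W W<K) (delete-∈ A i z∈ x≢y)))
  ...   | no  z≢x  = x∈p∪q⁺ (inj₁ (J⊆Z i (i∈ J⊆Z Z<J) (delete-∈ A i z∈ z≢x)))

  -- The index `i` has to go: `x` may lie outside `Z`, and `y` outside `W`. This loses one element,
  -- while the two strict inequalities supply two.
  ∩-⊆ : ∀ j → j ∈ (J ∩ K) - i → A j ⊆ Z ∩ W
  ∩-⊆ j j∈ z∈ with j ≟ i
  ... | yes refl = contradiction j∈ (x∉S-x (J ∩ K) i)
  ... | no  j≢i  with x∈p∩q⁻ J K (p─q⊆p (J ∩ K) ⁅ i ⁆ j∈)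
  ...   | j∈J , j∈K = x∈p∩q⁺ (away j j≢i J⊆Z j∈J z∈ , away j j≢i K⊆W j∈K z∈)

-- For a single index, Hall's condition makes the set nonempty. Two indices with the same
-- representative would give two sets inside one singleton, against the condition.
hall-singletons : ∀ (A : Vector (Subset m) k) → HallCondition A →
  (∀ i {x y} → x ∈ A i → y ∈ A i → x ≡ y) → SDR A
hall-singletons A hall single = s , s-injective , s∈
  where
  nonempty : ∀ i → Nonempty (A i)
  nonempty i = 1≤∣S∣⇒Nonempty (A i) (subst (_≤ ∣ A i ∣) (∣⁅x⁆∣≡1 i)
    (hall ⁅ i ⁆ (A i) λ j j∈ → subst (λ j → A j ⊆ A i) (sym (x∈⁅y⁆⇒x≡y i j∈)) λ z∈ → z∈))
  s : ∀ i → _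
  s i = proj₁ (nonempty i)
  s∈ : ∀ i → s i ∈ A i
  s∈ i = proj₂ (nonempty i)
  s-injective : Injective _≡_ _≡_ s
  s-injective {i} {j} si≡sj with i ≟ j
  ... | yes i≡j = i≡j
  ... | no  i≢j = contradiction (begin
    2                    ≤⟨ s≤s (x∈S⇒1≤∣S∣ (x∈p∧x≢y⇒x∈p-y {p = ij} (x∈p∪q⁺ (inj₂ (x∈⁅x⁆ j))) (i≢j ∘ sym))) ⟩
    suc ∣ ij - i ∣       ≤⟨ x∈p⇒∣p-x∣<∣p∣ {p = ij} (x∈p∪q⁺ (inj₁ (x∈⁅x⁆ i))) ⟩
    ∣ ij ∣               ≤⟨ hall ij ⁅ s i ⁆ ij⊆ ⟩
    ∣ ⁅ s i ⁆ ∣          ≡⟨ ∣⁅x⁆∣≡1 (s i) ⟩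
    1                    ∎) λ { (s≤s ()) }
    where
    open ≤-Reasoning
    ij = ⁅ i ⁆ ∪ ⁅ j ⁆
    ∈-single : ∀ {t} h → s h ≡ t → A h ⊆ ⁅ t ⁆
    ∈-single h refl z∈ = subst (_∈ _) (single h (s∈ h) z∈) (x∈⁅x⁆ _)
    ij⊆ : ∀ h → h ∈ ij → A h ⊆ ⁅ s i ⁆
    ij⊆ h h∈ with x∈p∪q⁻ ⁅ i ⁆ ⁅ j ⁆ h∈
    ... | inj₁ h∈i = ∈-single h (cong s (x∈⁅y⁆⇒x≡y i h∈i))
    ... | inj₂ h∈j = ∈-single h (trans (cong s (x∈⁅y⁆⇒x≡y j h∈j)) (sym si≡sj))

¬violation⇒condition : ∀ {A : Vector (Subset m) k} → ¬ HallViolation A → HallCondition A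
¬violation⇒condition ¬viol J Z J⊆Z = ≮⇒≥ λ Z<J → ¬viol (J , Z , J⊆Z , Z<J)

-- Rado's argument, by induction on the total size of the sets: if some set has two distinct
-- elements, one of them can be deleted without breaking Hall's condition, and an SDR of the smaller
-- family also serves the larger one.
hall : ∀ (A : Vector (Subset m) k) → HallCondition A → SDR A
hall A = go A (<-wellFounded _)
  where
  go : ∀ (A : Vector (Subset m) k) → Acc _<_ (sum (∣_∣ ∘ A)) → HallCondition A → SDR A
  go A (acc rec) cond
    with any? (λ i → any? (λ x → any? (λ y → (x ∈? A i) ×-dec (y ∈? A i) ×-dec ¬? (x ≟ y))))
  ... | no ¬two = hall-singletons A cond single
    where
    single : ∀ i {x y} → x ∈ A i → y ∈ A i → x ≡ y
    single i {x} {y} x∈ y∈ with x ≟ y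
    ... | yes x≡y = x≡y
    ... | no  x≢y = contradiction (i , x , y , x∈ , y∈ , x≢y) ¬two
  ... | yes (i , x , y , x∈ , y∈ , x≢y) = choose (hallViolation? (delete A i x))
    where
    shrink : ∀ z → z ∈ A i → ¬ HallViolation (delete A i z) → SDR A
    shrink z z∈ ¬viol with go (delete A i z) (rec (delete-∣∣ A i z∈)) (¬violation⇒condition ¬viol)
    ... | s , s-injective , s∈ = s , s-injective , λ j → delete-⊆ A i z j (s∈ j)
    choose : Dec (HallViolation (delete A i x)) → SDR A
    choose (no ¬viol) = shrink x x∈ ¬viol
    choose (yes viol) = shrink y y∈ (delete-one-of-two A i x≢y cond viol)

-- Pairwise balanced designs

-- Evaluated at the number of points of `U` on an item, it flags the items that avoid `U`.
isZero : ℕ → ℕ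
isZero zero    = 1
isZero (suc _) = 0

-- The integer x − a never lies strictly between 0 and 1, so (x − a)(x − a − 1) ≥ 0;
-- the inequality is expanded to avoid subtraction, and the case x = 0 is sharpened.
consecutive-≤ : ∀ a x →
  (a + suc a) * x + a * suc a * isZero x ≤ x * x + a * suc a
consecutive-≤ a zero = ≤-reflexive (cong₂ _+_ (*-zeroʳ (a + suc a)) (*-identityʳ (a * suc a)))
consecutive-≤ a x@(suc _) = ≤-trans (≤-reflexive (trans
  (cong ((a + suc a) * x +_) (*-zeroʳ (a * suc a))) (+-identityʳ _)))
  (bound x (≤-total x a))
  where
  -- The gap (x - a)(x - a - 1) is d + d² when a = x + d, and d² - d when x = a + d.
  below : ∀ x d → (x + d + suc (x + d)) * x + (d + d * d) ≡ x * x + (x + d) * suc (x + d)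
  below = solve-∀
  above : ∀ a d → (a + suc a) * (a + d) + d * d ≡ (a + d) * (a + d) + a * suc a + d
  above = solve-∀
  d≤d² : ∀ d → d ≤ d * d
  d≤d² zero    = z≤n
  d≤d² (suc d) = m≤m*n (suc d) (suc d)
  bound : ∀ x → x ≤ a Sum.⊎ a ≤ x → (a + suc a) * x ≤ x * x + a * suc a
  bound x (inj₁ x≤a) with d , refl ← m≤n⇒∃[o]m+o≡n x≤a =
    ≤-trans (m≤m+n _ (d + d * d)) (≤-reflexive (below x d))
  bound x (inj₂ a≤x) with d , refl ← m≤n⇒∃[o]m+o≡n a≤x = +-cancelʳ-≤ d _ _ (begin
    (a + suc a) * (a + d) + d              ≤⟨ +-monoʳ-≤ ((a + suc a) * (a + d)) (d≤d² d) ⟩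
    (a + suc a) * (a + d) + d * d          ≡⟨ above a d ⟩
    (a + d) * (a + d) + a * suc a + d      ∎)
    where open ≤-Reasoning

module PairwiseBalanced {n v ρ : ℕ} (X : Vector (Subset v) n)
  (replication : ∀ p → ∑[ i < n ] χ (X i) p ≡ suc ρ)
  (balance : ∀ {p r} → p ≢ r → ∑[ i < n ] (χ (X i) p * χ (X i) r) ≡ 1)
  (U : Subset v)
  where

  -- The numbers x_i of the overview.
  hits : Fin n → ℕ
  hits i = ∑[ p < v ] (χ U p * χ (X i) p)

  -- Double count of the incidences between items and points of `U`.
  ∑-hits : sum hits ≡ ∣ U ∣ * suc ρ
  ∑-hits = begin
    ∑[ i < n ] ∑[ p < v ] (χ U p * χ (X i) p)  ≡⟨ ∑-comm (λ i p → χ U p * χ (X i) p) ⟩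
    ∑[ p < v ] ∑[ i < n ] (χ U p * χ (X i) p)  ≡⟨ sum-cong-≗ (λ p → *-distribˡ-sum (χ U p) (λ i → χ (X i) p)) ⟨
    ∑[ p < v ] (χ U p * ∑[ i < n ] χ (X i) p)  ≡⟨ sum-cong-≗ (λ p → cong (χ U p *_) (replication p)) ⟩
    ∑[ p < v ] (χ U p * suc ρ)                 ≡⟨ *-distribʳ-sum (suc ρ) (χ U) ⟨
    sum (χ U) * suc ρ                          ≡⟨ cong (_* suc ρ) (∣S∣≡∑χ U) ⟨
    ∣ U ∣ * suc ρ                              ∎
    where open ≡-Reasoning

  -- With M the point-by-item incidence matrix, this is M Mᵀ = J + ρ I; `χ ⁅ p ⁆ r` is the Kronecker
  -- delta.
  concurrence : ∀ p r → ∑[ i < n ] (χ (X i) p * χ (X i) r) ≡ 1 + ρ * χ ⁅ p ⁆ r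
  concurrence p r with p ≟ r
  ... | yes refl = begin
    ∑[ i < n ] (χ (X i) p * χ (X i) p)  ≡⟨ sum-cong-≗ (λ i → χ-idem (X i) p) ⟩
    ∑[ i < n ] χ (X i) p                ≡⟨ replication p ⟩
    suc ρ                               ≡⟨ cong suc (*-identityʳ ρ) ⟨
    1 + ρ * 1                           ≡⟨ cong (λ c → 1 + ρ * c) (χ-∈ (x∈⁅x⁆ p)) ⟨
    1 + ρ * χ ⁅ p ⁆ p                   ∎
    where open ≡-Reasoning
  ... | no p≢r = begin
    ∑[ i < n ] (χ (X i) p * χ (X i) r)  ≡⟨ balance p≢r ⟩
    1                                   ≡⟨ cong suc (*-zeroʳ ρ) ⟨
    1 + ρ * 0                           ≡⟨ cong (λ c → 1 + ρ * c) (χ-∉ (x≢y⇒x∉⁅y⁆ (p≢r ∘ sym))) ⟨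
    1 + ρ * χ ⁅ p ⁆ r                   ∎
    where open ≡-Reasoning

  -- Row `p` of J + ρ I applied to the indicator vector of `U`.
  ∑-hits-through : ∀ p → ∑[ i < n ] (χ (X i) p * hits i) ≡ ∣ U ∣ + ρ * χ U p
  ∑-hits-through p = begin
    ∑[ i < n ] (χ (X i) p * hits i)
      ≡⟨ sum-cong-≗ (λ i → *-distribˡ-sum (χ (X i) p) (λ r → χ U r * χ (X i) r)) ⟩
    ∑[ i < n ] ∑[ r < v ] (χ (X i) p * (χ U r * χ (X i) r))
      ≡⟨ ∑-comm (λ i r → χ (X i) p * (χ U r * χ (X i) r)) ⟩
    ∑[ r < v ] ∑[ i < n ] (χ (X i) p * (χ U r * χ (X i) r))
      ≡⟨ sum-cong-≗ (λ r → sum-cong-≗ λ i → swap (χ (X i) p) (χ U r) (χ (X i) r)) ⟩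
    ∑[ r < v ] ∑[ i < n ] (χ U r * (χ (X i) p * χ (X i) r))
      ≡⟨ sum-cong-≗ (λ r → *-distribˡ-sum (χ U r) (λ i → χ (X i) p * χ (X i) r)) ⟨
    ∑[ r < v ] (χ U r * ∑[ i < n ] (χ (X i) p * χ (X i) r))
      ≡⟨ sum-cong-≗ (λ r → trans (cong (χ U r *_) (concurrence p r)) (expand (χ U r) (χ ⁅ p ⁆ r) ρ)) ⟩
    ∑[ r < v ] (χ U r + ρ * (χ U r * χ ⁅ p ⁆ r))
      ≡⟨ ∑-distrib-+ (χ U) (λ r → ρ * (χ U r * χ ⁅ p ⁆ r)) ⟩
    sum (χ U) + ∑[ r < v ] (ρ * (χ U r * χ ⁅ p ⁆ r))
      ≡⟨ cong₂ _+_ (sym (∣S∣≡∑χ U)) (sym (*-distribˡ-sum ρ (λ r → χ U r * χ ⁅ p ⁆ r))) ⟩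
    ∣ U ∣ + ρ * ∑[ r < v ] (χ U r * χ ⁅ p ⁆ r)
      ≡⟨ cong (λ c → ∣ U ∣ + ρ * c) (sum-support (λ r → χ U r * χ ⁅ p ⁆ r) p
           λ r r≢p → trans (cong (χ U r *_) (χ-∉ (x≢y⇒x∉⁅y⁆ r≢p))) (*-zeroʳ (χ U r))) ⟩
    ∣ U ∣ + ρ * (χ U p * χ ⁅ p ⁆ p)
      ≡⟨ cong (λ c → ∣ U ∣ + ρ * c) (trans (cong (χ U p *_) (χ-∈ (x∈⁅x⁆ p))) (*-identityʳ (χ U p))) ⟩
    ∣ U ∣ + ρ * χ U p
      ∎
    where
    open ≡-Reasoning
    swap : ∀ a b c → a * (b * c) ≡ b * (a * c)
    swap = solve-∀
    expand : ∀ a c ρ → a * (1 + ρ * c) ≡ a + ρ * (a * c)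
    expand = solve-∀

  -- Expanding one factor of each square over the points of `U` leaves the sum of `∑-hits-through p`
  -- over `p` in `U`.
  ∑-hits² : ∑[ i < n ] (hits i * hits i) ≡ ∣ U ∣ * (∣ U ∣ + ρ)
  ∑-hits² = begin
    ∑[ i < n ] (hits i * hits i)
      ≡⟨ sum-cong-≗ (λ i → *-distribʳ-sum (hits i) (λ p → χ U p * χ (X i) p)) ⟩
    ∑[ i < n ] ∑[ p < v ] (χ U p * χ (X i) p * hits i)
      ≡⟨ ∑-comm (λ i p → χ U p * χ (X i) p * hits i) ⟩
    ∑[ p < v ] ∑[ i < n ] (χ U p * χ (X i) p * hits i)
      ≡⟨ sum-cong-≗ (λ p → sum-cong-≗ λ i → *-assoc (χ U p) (χ (X i) p) (hits i)) ⟩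
    ∑[ p < v ] ∑[ i < n ] (χ U p * (χ (X i) p * hits i))
      ≡⟨ sum-cong-≗ (λ p → *-distribˡ-sum (χ U p) (λ i → χ (X i) p * hits i)) ⟨
    ∑[ p < v ] (χ U p * ∑[ i < n ] (χ (X i) p * hits i))
      ≡⟨ sum-cong-≗ (λ p → trans (cong (χ U p *_) (∑-hits-through p)) (absorb p)) ⟩
    ∑[ p < v ] (χ U p * (∣ U ∣ + ρ))
      ≡⟨ *-distribʳ-sum (∣ U ∣ + ρ) (χ U) ⟨
    sum (χ U) * (∣ U ∣ + ρ)
      ≡⟨ cong (_* (∣ U ∣ + ρ)) (∣S∣≡∑χ U) ⟨
    ∣ U ∣ * (∣ U ∣ + ρ)
      ∎
    where
    open ≡-Reasoning
    -- Outside `U` both sides vanish; inside, the inner `χ U p` is 1.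
    absorb : ∀ p → χ U p * (∣ U ∣ + ρ * χ U p) ≡ χ U p * (∣ U ∣ + ρ)
    absorb p with lookup U p
    ... | true  = cong (λ c → 1 * (∣ U ∣ + c)) (*-identityʳ ρ)
    ... | false = refl

  missed : ℕ
  missed = ∑[ i < n ] isZero (hits i)

  -- `consecutive-≤ a` summed over all items, with the first two moments of `hits` inserted.
  missed-≤ : ∀ a → (a + suc a) * (∣ U ∣ * suc ρ) + a * suc a * missed ≤
                   ∣ U ∣ * (∣ U ∣ + ρ) + a * suc a * n
  missed-≤ a = begin
    (a + suc a) * (∣ U ∣ * suc ρ) + a * suc a * missed
      ≡⟨ cong (λ c → (a + suc a) * c + a * suc a * missed) ∑-hits ⟨
    (a + suc a) * sum hits + a * suc a * missed
      ≡⟨ cong₂ _+_ (*-distribˡ-sum (a + suc a) hits) (*-distribˡ-sum (a * suc a) (isZero ∘ hits)) ⟩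
    ∑[ i < n ] ((a + suc a) * hits i) + ∑[ i < n ] (a * suc a * isZero (hits i))
      ≡⟨ ∑-distrib-+ (λ i → (a + suc a) * hits i) _ ⟨
    ∑[ i < n ] ((a + suc a) * hits i + a * suc a * isZero (hits i))
      ≤⟨ sum-mono-≤ (λ i → consecutive-≤ a (hits i)) ⟩
    ∑[ i < n ] (hits i * hits i + a * suc a)
      ≡⟨ ∑-distrib-+ (λ i → hits i * hits i) _ ⟩
    ∑[ i < n ] (hits i * hits i) + ∑[ i < n ] (a * suc a)
      ≡⟨ cong₂ _+_ ∑-hits² (trans (sum-const n (a * suc a)) (*-comm n (a * suc a))) ⟩
    ∣ U ∣ * (∣ U ∣ + ρ) + a * suc a * n
      ∎
    where open ≤-Reasoning

  -- An item disjoint from `U` has `hits` equal to 0 and so adds 1 to `missed`; injectivity of `x`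
  -- keeps items from being counted twice.
  subfamily-≤-missed : ∀ (x : Fin k → Fin n) → Injective _≡_ _≡_ x → ∀ J →
    (∀ j → j ∈ J → ∀ {p} → p ∈ X (x j) → p ∉ U) → ∣ J ∣ ≤ missed
  subfamily-≤-missed x x-injective J disjoint = begin
    ∣ J ∣                      ≡⟨ ∣S∣≡∑χ J ⟩
    sum (χ J)                  ≤⟨ sum-mono-≤ χ≤ ⟩
    sum (isZero ∘ hits ∘ x)    ≤⟨ sum-injective-≤ x x-injective (isZero ∘ hits) ⟩
    missed                     ∎
    where
    open ≤-Reasoning
    χ≤ : ∀ j → χ J j ≤ isZero (hits (x j))
    χ≤ j with j ∈? J
    ... | no  j∉J = ≤-trans (≤-reflexive (χ-∉ j∉J)) z≤n
    ... | yes j∈J = ≤-reflexive (trans (χ-∈ j∈J) (cong isZero (sym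
      (sum-≡0 λ p → χχ-∉ {S = U} {X (x j)} {p} {p} λ (p∈U , p∈X) → disjoint j j∈J p∈X p∈U))))

-- Resolvable transversal designs

module _ {ℓ h : ℕ} (D : TransversalDesign ℓ h) where
  open TransversalDesign D
  open StorageScheme (designCode D) using (stored; #items)

  -- Two points of one group share that group and no block, since a block meets the group only once;
  -- points of different groups share exactly one block and no group.
  stored-balance : ∀ {p r} → p ≢ r → ∑[ i < #items ] (χ (stored i) p * χ (stored i) r) ≡ 1
  stored-balance {p} {r} p≢r =
    trans (sum-++ (λ S → χ S p * χ S r) block group)
      (by-groups (groups-partition p) (groups-partition r))
    where
    by-groups : ∃! _≡_ (λ i → p ∈ group i) → ∃! _≡_ (λ i → r ∈ group i) →
      ∑[ b < #blocks ] (χ (block b) p * χ (block b) r) +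
      ∑[ i < ℓ ] (χ (group i) p * χ (group i) r) ≡ 1
    by-groups (i , p∈i , i-unique) (j , r∈j , j-unique) with i ≟ j
    ... | yes refl = cong₂ _+_
      (sum-≡0 λ b → χχ-∉ {S = block b} {block b} {p} {r} λ (p∈b , r∈b) →
        let _ , _ , unique = block-meets-group-once b i
        in p≢r (trans (sym (unique (p∈b , p∈i))) (unique (r∈b , r∈j))))
      (sum-∃! {P = λ g → p ∈ group g × r ∈ group g}
        (i , (p∈i , r∈j) , λ (p∈g , _) → i-unique p∈g) χχ-∈ χχ-∉)
    ... | no i≢j = cong₂ _+_
      (sum-∃! (pair-in-unique-block i≢j p∈i r∈j) χχ-∈ χχ-∉)
      (sum-≡0 λ g → χχ-∉ {S = group g} {group g} {p} {r} λ (p∈g , r∈g) →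
        i≢j (trans (i-unique p∈g) (sym (j-unique r∈g))))

  module _ (R : Resolvable D) where
    open Resolvable R

    ∑-classes : ∀ b → ∑[ c < h ] χ (class c) b ≡ 1
    ∑-classes b = sum-∃! (classes-partition b) χ-∈ χ-∉

    -- Each block lies in one of the `h` classes, and each class has `h` blocks.
    #blocks≡h*h : #blocks ≡ h * h
    #blocks≡h*h = begin
      #blocks                                   ≡⟨ trans (sum-const #blocks 1) (*-identityʳ #blocks) ⟨
      ∑[ b < #blocks ] 1                        ≡⟨ sum-cong-≗ ∑-classes ⟨
      ∑[ b < #blocks ] ∑[ c < h ] χ (class c) b ≡⟨ ∑-comm (λ b c → χ (class c) b) ⟩
      ∑[ c < h ] sum (χ (class c))              ≡⟨ sum-cong-≗ (λ c → trans (sym (∣S∣≡∑χ (class c))) (class-size c)) ⟩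
      ∑[ c < h ] h                              ≡⟨ sum-const h h ⟩
      h * h                                     ∎
      where open ≡-Reasoning

    -- Sorting the blocks by class leaves exactly one block through `p` in each of the `h` classes.
    block-replication : ∀ p → ∑[ b < #blocks ] χ (block b) p ≡ h
    block-replication p = begin
      ∑[ b < #blocks ] χ (block b) p
        ≡⟨ sum-cong-≗ (λ b → trans (cong (_* χ (block b) p) (∑-classes b)) (*-identityˡ _)) ⟨
      ∑[ b < #blocks ] (∑[ c < h ] χ (class c) b * χ (block b) p)
        ≡⟨ sum-cong-≗ (λ b → *-distribʳ-sum (χ (block b) p) (λ c → χ (class c) b)) ⟩
      ∑[ b < #blocks ] ∑[ c < h ] (χ (class c) b * χ (block b) p)
        ≡⟨ ∑-comm (λ b c → χ (class c) b * χ (block b) p) ⟩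
      ∑[ c < h ] ∑[ b < #blocks ] (χ (class c) b * χ (block b) p)
        ≡⟨ sum-cong-≗ (λ c → sum-∃! (class-parallel c p) χχ-∈ χχ-∉) ⟩
      ∑[ c < h ] 1
        ≡⟨ trans (sum-const h 1) (*-identityʳ h) ⟩
      h
        ∎
      where open ≡-Reasoning

    stored-replication : ∀ p → ∑[ i < #items ] χ (stored i) p ≡ suc h
    stored-replication p = begin
      ∑[ i < #items ] χ (stored i) p
        ≡⟨ sum-++ (λ S → χ S p) block group ⟩
      ∑[ b < #blocks ] χ (block b) p + ∑[ i < ℓ ] χ (group i) p
        ≡⟨ cong₂ _+_ (block-replication p) (sum-∃! (groups-partition p) χ-∈ χ-∉) ⟩
      h + 1
        ≡⟨ +-comm h 1 ⟩
      suc h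
        ∎
      where open ≡-Reasoning

    stored-total : ∑[ i < #items ] ∣ stored i ∣ ≡ h * h * ℓ + ℓ * h
    stored-total = begin
      ∑[ i < #items ] ∣ stored i ∣
        ≡⟨ sum-++ ∣_∣ block group ⟩
      ∑[ b < #blocks ] ∣ block b ∣ + ∑[ i < ℓ ] ∣ group i ∣
        ≡⟨ cong₂ _+_ (sum-cong-≗ block-size) (sum-cong-≗ group-size) ⟩
      ∑[ b < #blocks ] ℓ + ∑[ i < ℓ ] h
        ≡⟨ cong₂ _+_ (sum-const #blocks ℓ) (sum-const ℓ h) ⟩
      #blocks * ℓ + ℓ * h
        ≡⟨ cong (λ b → b * ℓ + ℓ * h) #blocks≡h*h ⟩
      h * h * ℓ + ℓ * h
        ∎
      where open ≡-Reasoning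

-- Numerical estimates for the two ranges of u

-- The estimate for a = 1 settles 2 ≤ u ≤ 2q − 1, by (u − 2)(2q − 1 − u) ≥ 0.
few-uncovered : ∀ {ℓ n u z f} → 2 ≤ u → u ≤ ℓ + suc ℓ → suc n ≡ z + u + (suc ℓ + suc ℓ) →
  3 * (u * suc (suc ℓ)) + 2 * f ≤ u * (u + suc ℓ) + 2 * n → f ≤ z
few-uncovered {ℓ} {n} {u} {z} {f} 2≤u u≤ n≡ H with m≤n⇒∃[o]m+o≡n 2≤u | m≤n⇒∃[o]m+o≡n u≤
-- Here s = u - 2 and t = 2q - 1 - u, and `s * t` is the slack. The 2 added to both sides turns
-- `2 * n` into `2 * suc n`, to which `n≡` applies.
... | s , refl | t , 2+s+t≡ = *-cancelˡ-≤ 2 (+-cancelˡ-≤ (3 * (u * suc (suc ℓ))) _ _ (≤-trans H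
  (+-cancelʳ-≤ 2 _ _ (≤-trans (m≤m+n _ (s * t)) (≤-reflexive identity)))))
  where
  open ≡-Reasoning
  q = suc ℓ
  collect : ∀ n u q s t → u * (u + q) + 2 * n + 2 + s * t ≡ u * (u + q) + 2 * suc n + s * t
  collect = solve-∀
  split-q : ∀ z u q s t → u * (u + q) + 2 * (z + u + (q + q)) + s * t ≡
    u * q + (u * u + 2 * (z + u) + 2 * (q + q) + s * t)
  split-q = solve-∀
  expand : ∀ z s t → (2 + s) * (2 + s) + 2 * (z + (2 + s)) + 2 * suc (2 + s + t) + s * t ≡
    (2 + s) * suc (2 + s + t) + 3 * (2 + s) + 2 * z + 2
  expand = solve-∀
  join-q : ∀ z u q → u * q + (u * (q + q) + 3 * u + 2 * z + 2) ≡ 3 * (u * suc q) + 2 * z + 2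
  join-q = solve-∀
  identity : u * (u + q) + 2 * n + 2 + s * t ≡ 3 * (u * suc q) + 2 * z + 2
  identity = begin
    u * (u + q) + 2 * n + 2 + s * t
      ≡⟨ collect n u q s t ⟩
    u * (u + q) + 2 * suc n + s * t
      ≡⟨ cong (λ n → u * (u + q) + 2 * n + s * t) n≡ ⟩
    u * (u + q) + 2 * (z + u + (q + q)) + s * t
      ≡⟨ split-q z u q s t ⟩
    u * q + (u * u + 2 * (z + u) + 2 * (q + q) + s * t)
      -- Only `q + q` is rewritten, as suc (2 + s + t), so that `expand` is a polynomial identity in
      -- z, s and t.
      ≡⟨ cong (u * q +_) (trans
           (cong (λ Q → u * u + 2 * (z + u) + 2 * suc Q + s * t) (sym 2+s+t≡))
           (trans (expand z s t) (cong (λ Q → u * suc Q + 3 * u + 2 * z + 2) 2+s+t≡))) ⟩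
    u * q + (u * (q + q) + 3 * u + 2 * z + 2)
      ≡⟨ join-q z u q ⟩
    3 * (u * suc q) + 2 * z + 2
      ∎

-- The estimate for a = q − 1 settles u ≥ 2q − 1, by z (u − (2q − 1)) ≥ 0.
many-uncovered : ∀ {ℓ n u z f} → 1 ≤ ℓ → ℓ + suc ℓ ≤ u →
  z + u ≡ ℓ * suc ℓ → n ≡ z + u + (ℓ + suc ℓ) →
  (ℓ + suc ℓ) * (u * suc (suc ℓ)) + ℓ * suc ℓ * f ≤ u * (u + suc ℓ) + ℓ * suc ℓ * n → f ≤ z
-- With `ℓ` a successor, the factor `ℓ * suc ℓ` is visibly nonzero, as its cancellation requires.
many-uncovered {ℓ@(suc _)} {n} {u} {z} {f} _ ≤u m≡ refl H with m≤n⇒∃[o]m+o≡n ≤u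
... | t , refl = *-cancelˡ-≤ (ℓ * suc ℓ) (+-cancelˡ-≤ ((ℓ + suc ℓ) * (u * suc (suc ℓ))) _ _
  (≤-trans H (≤-trans (m≤m+n _ (z * t)) (≤-reflexive identity))))
  where
  open ≡-Reasoning
  -- The coefficient a (a + 1) = q (q - 1) equals the number of points z + u. Replacing it makes the
  -- identity polynomial in ℓ, t and z, with slack z t for t = u - (2q - 1).
  expand : ∀ ℓ t z → let u = ℓ + suc ℓ + t in
    u * (u + suc ℓ) + (z + u) * (z + u + (ℓ + suc ℓ)) + z * t ≡
    u * (2 * (z + u) + (3 * ℓ + 2)) + (z + u) * z
  expand = solve-∀
  join : ∀ ℓ u m → u * (2 * (ℓ * suc ℓ) + (3 * ℓ + 2)) + m ≡ (ℓ + suc ℓ) * (u * suc (suc ℓ)) + m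
  join = solve-∀
  identity : u * (u + suc ℓ) + ℓ * suc ℓ * (z + u + (ℓ + suc ℓ)) + z * t ≡
    (ℓ + suc ℓ) * (u * suc (suc ℓ)) + ℓ * suc ℓ * z
  identity = begin
    u * (u + suc ℓ) + ℓ * suc ℓ * (z + u + (ℓ + suc ℓ)) + z * t
      ≡⟨ cong (λ m → u * (u + suc ℓ) + m * (z + u + (ℓ + suc ℓ)) + z * t) m≡ ⟨
    u * (u + suc ℓ) + (z + u) * (z + u + (ℓ + suc ℓ)) + z * t
      ≡⟨ expand ℓ t z ⟩
    u * (2 * (z + u) + (3 * ℓ + 2)) + (z + u) * z
      ≡⟨ cong (λ m → u * (2 * m + (3 * ℓ + 2)) + m * z) m≡ ⟩
    u * (2 * (ℓ * suc ℓ) + (3 * ℓ + 2)) + ℓ * suc ℓ * z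
      ≡⟨ join ℓ u _ ⟩
    (ℓ + suc ℓ) * (u * suc (suc ℓ)) + ℓ * suc ℓ * z
      ∎

-- Parameters of the code and retrieval

theorem12 : ∀ (q : ℕ) → 3 ≤ q → IsPrimePower q →
    (D : TransversalDesign (q ∸ 1) q) → Resolvable D →
    IsCBC (q ^ 2 + q ∸ 1) (q ^ 3 ∸ q) (q ^ 2 ∸ q ∸ 1) (q ^ 2 ∸ q) (designCode D)
theorem12 q@(suc ℓ) (s≤s 2≤ℓ) _ D R = record
  { items       = trans #items≡ (cong (_∸ 1) (sym (trans (cong (λ s → s + q) q²) (+-suc (q * q) ℓ))))
  ; servers     = servers≡
  ; storage     = trans (stored-total D R)
      (trans (sym (m+n∸n≡m _ q)) (cong (_∸ q) (cube ℓ)))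
  ; retrievable = λ x x-injective → hall (stored ∘ x) (condition x x-injective)
  }
  where
  open TransversalDesign D using (#blocks)
  open StorageScheme (designCode D)

  q² : q ^ 2 ≡ q * q
  q² = cong (q *_) (*-identityʳ q)

  -- Adding q to the total storage gives q³, so the truncated subtraction is exact; the right side
  -- is `q ^ 3` unfolded.
  cube : ∀ ℓ → suc ℓ * suc ℓ * ℓ + ℓ * suc ℓ + suc ℓ ≡ suc ℓ * (suc ℓ * (suc ℓ * 1))
  cube = solve-∀

  #items≡ : #items ≡ q * q + ℓ
  #items≡ = cong (_+ ℓ) (#blocks≡h*h D R)

  servers≡ : ℓ * q ≡ q ^ 2 ∸ q
  servers≡ = trans (sym (m+n∸n≡m (ℓ * q) q)) (cong (_∸ q) (trans (+-comm (ℓ * q) q) (sym q²)))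

  condition : ∀ (x : Fin (q ^ 2 ∸ q ∸ 1) → Fin #items) → Injective _≡_ _≡_ x →
    HallCondition (stored ∘ x)
  condition x x-injective J Z J⊆Z with 2 ≤? ∣ ∁ Z ∣
  -- Since k is one less than the number of servers, a `Z` missing at most one server has at least k
  -- elements.
  ... | no 2≰u = begin
    ∣ J ∣                      ≤⟨ ∣p∣≤n J ⟩
    q ^ 2 ∸ q ∸ 1              ≡⟨ cong (_∸ 1) (trans (sym servers≡) (sym (∣S∣+∣∁S∣≡v Z))) ⟩
    ∣ Z ∣ + ∣ ∁ Z ∣ ∸ 1        ≤⟨ ∸-monoˡ-≤ 1 (+-monoʳ-≤ ∣ Z ∣ (≤-pred (≰⇒> 2≰u))) ⟩
    ∣ Z ∣ + 1 ∸ 1              ≡⟨ m+n∸n≡m ∣ Z ∣ 1 ⟩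
    ∣ Z ∣                      ∎
    where open ≤-Reasoning
  -- For the complement of `Z`, `missed` counts all items inside `Z`, hence bounds the chosen ones.
  ... | yes 2≤u = ≤-trans
    (subfamily-≤-missed x x-injective J λ j j∈J p∈ p∈∁Z → x∈∁p⇒x∉p p∈∁Z (J⊆Z j j∈J p∈))
    (missed-≤Z (≤-total ∣ ∁ Z ∣ (ℓ + q)))
    where
    open PairwiseBalanced stored (stored-replication D R) (stored-balance D) (∁ Z)
    -- There are 2q - 1 more items than servers: q² + q - 1 against q² - q.
    count : #items ≡ ∣ Z ∣ + ∣ ∁ Z ∣ + (ℓ + q)
    count = trans #items≡ (trans (regroup ℓ) (cong (_+ (ℓ + q)) (sym (∣S∣+∣∁S∣≡v Z))))
      where
      regroup : ∀ ℓ → suc ℓ * suc ℓ + ℓ ≡ ℓ * suc ℓ + (ℓ + suc ℓ)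
      regroup = solve-∀
    missed-≤Z : ∣ ∁ Z ∣ ≤ ℓ + q Sum.⊎ ℓ + q ≤ ∣ ∁ Z ∣ → missed ≤ ∣ Z ∣
    -- `missed-≤ 1` has coefficients 3 and 2; `missed-≤ ℓ` is the case a = q - 1, with coefficients
    -- 2q - 1 and q (q - 1).
    missed-≤Z (inj₁ u≤) = few-uncovered 2≤u u≤ (trans (cong suc count) (sym (+-suc _ _))) (missed-≤ 1)
    missed-≤Z (inj₂ ≤u) = many-uncovered (≤-trans (s≤s z≤n) 2≤ℓ) ≤u (∣S∣+∣∁S∣≡v Z) count (missed-≤ ℓ)
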